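{- Let $k\in\mathbb{N}$ be a constant and $(G_n)_{n\in\mathbb{N}}$ a family of groups with $G_n\le\mathrm{Sym}_n$ such that $[\mathrm{Sym}_n:G_n]\le 2^{nk}$ for all sufficiently large $n$. Then there is no constant $0<c\le 1$ such that for all sufficiently large $n$ there exists $\Delta_n\subseteq[n]$ with $|\Delta_n|\ge cn$ on which $\mathrm{SP}_A(G_n)$ contains only singleton parts (i.e. every element of $\Delta_n$ forms a singleton part of $\mathrm{SP}_A(G_n)$).
   Context: For a finite set $A$ and $G\le\mathrm{Sym}(A)$, an alternating supporting partition of $G$ is a partition $\mathcal{P}$ of $A$ such that $\prod_{P\in\mathcal{P},|P|<5}\mathrm{Sym}(P)\times\prod_{P\in\mathcal{P},|P|\ge5}\mathrm{Alt}(P)\le G$ (each factor acting on its part and fixing all other points). Every such $G$ has a unique coarsest alternating supporting partition (every alternating supporting partition of $G$ refines it), denoted $\mathrm{SP}_A(G)$. -}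

module Defs where

open import Data.Nat using (ℕ; _≤_; _<_; _*_; _^_)
open import Data.Nat.Divisibility using (_∣_)
open import Data.Fin using (Fin) renaming (_<_ to _<ᶠ_; _≟_ to _≟ᶠ_; _<?_ to _<?ᶠ_)
open import Data.Fin.Subset using (Subset; _∈_; ∣_∣)
open import Data.Fin.Permutation using (Permutation′; _⟨$⟩ʳ_; _≈_; id; flip; _∘ₚ_)
open import Data.List using (List; length; filter; allFin; cartesianProduct)
open import Data.Vec using (Vec; lookup)
open import Data.Product using (Σ; _×_; _,_; proj₁; proj₂; ∃-syntax)
open import Relation.Nullary using (_×-dec_)
open import Relation.Binary.PropositionalEquality using (_≡_)

record IsSubgroup {n : ℕ} (G : Permutation′ n → Set) : Set where
  field
    respects : ∀ {π σ} → π ≈ σ → G π → G σ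
    has-id   : G id
    closed-∘ : ∀ {π σ} → G π → G σ → G (π ∘ₚ σ)
    closed-⁻¹ : ∀ {π} → G π → G (flip π)

-- [Sym_n : G] ≤ m : there are at most m cosets of G in Sym_n, i.e. Sym_n is
-- covered by m (left) cosets σ₁G, …, σₘG  (π ∈ σG ⇔ σ⁻¹π ∈ G).
IndexAtMost : {n : ℕ} → (Permutation′ n → Set) → ℕ → Set
IndexAtMost {n} G m =
  Σ (Vec (Permutation′ n) m) λ reps →
    ∀ (π : Permutation′ n) → ∃[ i ] G (π ∘ₚ flip (lookup reps i))

-- A partition of Fin n is given by a labelling: x and y lie in the same part
-- iff they have the same label.
Partition : ℕ → Set
Partition n = Fin n → Fin n

partSize : ∀ {n} → Partition n → Fin n → ℕ
partSize {n} P x = length (filter (λ y → P y ≟ᶠ P x) (allFin n))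

inversionsIn : ∀ {n} → Partition n → Fin n → Permutation′ n → ℕ
inversionsIn {n} P x π =
  length (filter (λ ij → ((P (proj₁ ij) ≟ᶠ P x) ×-dec (P (proj₂ ij) ≟ᶠ P x))
                          ×-dec ((proj₁ ij <?ᶠ proj₂ ij)
                          ×-dec ((π ⟨$⟩ʳ proj₂ ij) <?ᶠ (π ⟨$⟩ʳ proj₁ ij))))
                 (cartesianProduct (allFin n) (allFin n)))

-- membership in  ∏_{|P|<5} Sym(P) × ∏_{|P|≥5} Alt(P) :
-- π maps every part to itself, and on every part of size ≥ 5 its restriction
-- is an even permutation (even number of inversions).
InProduct : ∀ {n} → Partition n → Permutation′ n → Set
InProduct P π =
  (∀ x → P (π ⟨$⟩ʳ x) ≡ P x) ×
  (∀ x → 5 ≤ partSize P x → 2 ∣ inversionsIn P x π)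

IsASP : ∀ {n} → (Permutation′ n → Set) → Partition n → Set
IsASP G P = ∀ π → InProduct P π → G π

Refines : ∀ {n} → Partition n → Partition n → Set
Refines Q P = ∀ x y → Q x ≡ Q y → P x ≡ P y

IsSPA : ∀ {n} → (Permutation′ n → Set) → Partition n → Set
IsSPA G P = IsASP G P × (∀ Q → IsASP G Q → Refines Q P)

IsSingletonPart : ∀ {n} → Partition n → Fin n → Set
IsSingletonPart P x = ∀ y → P y ≡ P x → y ≡ x

LargeSingletonSet : ∀ {n} → (Permutation′ n → Set) → ℕ → ℕ → Set
LargeSingletonSet {n} G p q =
  Σ (Subset n) λ Δ → (p * n ≤ q * ∣ Δ ∣) ×
    (Σ (Partition n) λ P → IsSPA G P × (∀ x → x ∈ Δ → IsSingletonPart P x))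

{-# OPTIONS --safe #-}

-- Call a set Γ independent if only the identity of G is supported in Γ. Then
-- distinct elements of Sym(Γ) lie in distinct cosets, so |Γ|! ≤ [Sym_n : G],
-- which forces |Γ| = o(n). If |Δ| ≥ cn one can therefore pick, one after the
-- other, four disjoint maximal independent subsets Γ₁, …, Γ₄ of what is left of
-- Δ and still have a point x over. By maximality there are gᵢ ∈ G moving x and
-- supported in Γᵢ ∪ {x}. The supports of gᵢ and gⱼ meet in x only, so [gᵢ , gⱼ]
-- is the three-cycle (x  gᵢx  gⱼx), and these three-cycles generate the
-- alternating group on {x , g₁x , … , g₄x}. Hence G has an alternating
-- supporting partition in which x ∈ Δ is not a singleton.
module Submission where

open import Defs
open import Data.Nat using (ℕ; zero; suc; _+_; _*_; _^_; _!; _≤_; _<_; z≤n; s≤s; NonZero; >-nonZero⁻¹)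
import Data.Nat.Properties as ℕ
open import Data.Nat.Divisibility using (_∣_; _∣?_)
open import Data.Nat.Tactic.RingSolver using (solve-∀)
open import Data.Bool using (if_then_else_)
open import Data.Fin using (Fin; zero; suc; _≟_; _<?_; remQuot; combine; punchIn) renaming (_<_ to _<ᶠ_)
open import Data.Fin.Patterns using (0F; 1F; 2F; 3F; 4F)
import Data.Fin.Properties as Fin
open import Data.Fin.Subset using (Subset; ∣_∣; inside; outside) renaming (_∈_ to _∈ˢ_)
open import Data.Fin.Permutation
  using (Permutation′; permutation; _⟨$⟩ʳ_; _⟨$⟩ˡ_; inverseˡ; inverseʳ; _≈_; id; flip; _∘ₚ_; insert; insert-punchIn)
open import Data.List using (List; []; _∷_; _++_; length; map; filter; allFin; cartesianProduct; lookup; tabulate)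
import Data.List.Properties as List
open import Data.List.Membership.Propositional using (_∈_; _∉_)
open import Data.List.Membership.Propositional.Properties
  using (∈-lookup; ∈-map⁺; ∈-map⁻; ∈-filter⁺; ∈-filter⁻; ∈-++⁺ˡ; ∈-++⁺ʳ; ∈-allFin; ∈-cartesianProduct⁺; ∈-tabulate⁻; ∈-tabulate⁺)
import Data.List.Membership.DecPropositional as DecMembership
open import Data.List.Relation.Unary.Any using (here; there; index)
import Data.List.Relation.Unary.Any.Properties as Any
open import Data.List.Relation.Unary.All using (All; []; _∷_)
import Data.List.Relation.Unary.All as All
import Data.List.Relation.Unary.All.Properties as All
open import Data.List.Relation.Unary.AllPairs using (AllPairs; []; _∷_)
import Data.List.Relation.Unary.AllPairs.Properties as AllPairs
open import Data.List.Relation.Unary.Unique.Propositional using (Unique)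
import Data.List.Relation.Unary.Unique.Propositional.Properties as Unique
open import Data.List.Relation.Binary.Permutation.Propositional using (_↭_; ↭-refl; ↭-sym; ↭-trans; prep; ↭⇒↭ₛ)
open import Data.List.Relation.Binary.Permutation.Propositional.Properties using (↭-length; shift; ∈-resp-↭)
import Data.List.Relation.Binary.Permutation.Setoid.Properties as ↭ₛ
open import Data.Product using (Σ; _×_; _,_; proj₁; proj₂; ∃-syntax; ∃₂)
open import Data.Sum using (_⊎_; inj₁; inj₂; swap)
open import Data.Empty using (⊥)
open import Data.Vec using (Vec; []; _∷_)
import Data.Vec as Vec
import Data.Vec.Properties as Vec
open import Function using (_∘_)
open import Relation.Nullary using (¬_; Dec; yes; no; does; contradiction; ¬?; _×-dec_; _→-dec_)
open import Relation.Nullary.Decidable using (toWitness)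
open import Relation.Binary.Definitions using (tri<; tri≈; tri>)
open import Relation.Binary.PropositionalEquality
  using (_≡_; _≢_; refl; sym; trans; cong; cong₂; subst; subst₂; setoid; module ≡-Reasoning)

open module Dec∈ {n} = DecMembership (_≟_ {n}) using (_∈?_)

private
  variable
    n ℓ : ℕ

-- Injectivity and duplicate-free lists.

⟨$⟩ʳ-injective : (π : Permutation′ n) → ∀ {x y} → π ⟨$⟩ʳ x ≡ π ⟨$⟩ʳ y → x ≡ y
⟨$⟩ʳ-injective π e = trans (sym (inverseˡ π)) (trans (cong (π ⟨$⟩ˡ_) e) (inverseˡ π))

lookup-<⁺ : ∀ {A : Set} {R : A → A → Set} {xs} → AllPairs R xs →
            ∀ {i j} → i <ᶠ j → R (lookup xs i) (lookup xs j)
lookup-<⁺ (rs ∷ _) {zero}  {suc j} _         = All.lookup rs (∈-lookup j)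
lookup-<⁺ (_ ∷ ps) {suc i} {suc j} (s≤s i<j) = lookup-<⁺ ps i<j

lookup-injective : ∀ {A : Set} {xs : List A} → Unique xs → ∀ {i j} → lookup xs i ≡ lookup xs j → i ≡ j
lookup-injective {xs = x ∷ xs} (x∉ ∷ u) {zero}  {zero}  e = refl
lookup-injective {xs = x ∷ xs} (x∉ ∷ u) {zero}  {suc j} e = contradiction e (All.lookup x∉ (∈-lookup j))
lookup-injective {xs = x ∷ xs} (x∉ ∷ u) {suc i} {zero}  e = contradiction (sym e) (All.lookup x∉ (∈-lookup i))
lookup-injective {xs = x ∷ xs} (x∉ ∷ u) {suc i} {suc j} e = cong suc (lookup-injective u e)

Unique-⊆-length : ∀ {A : Set} {xs ys : List A} → Unique xs → (∀ {x} → x ∈ xs → x ∈ ys) → length xs ≤ length ys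
Unique-⊆-length {xs = xs} {ys} u sub = Fin.injective⇒≤ {f = f} λ {i} {j} e →
  lookup-injective u (trans (Any.lookup-index (sub (∈-lookup i)))
    (trans (cong (lookup ys) e) (sym (Any.lookup-index (sub (∈-lookup j))))))
  where
  f : Fin (length xs) → Fin (length ys)
  f i = index (sub (∈-lookup i))

Unique-++⁻ : ∀ {A : Set} (xs : List A) {ys} → Unique (xs ++ ys) →
             Unique xs × Unique ys × (∀ {x} → x ∈ xs → x ∉ ys)
Unique-++⁻ []       u        = [] , u , λ ()
Unique-++⁻ (x ∷ xs) (x∉ ∷ u) with uxs , uys , disjoint ← Unique-++⁻ xs u =
  All.++⁻ˡ xs x∉ ∷ uxs , uys ,
  λ { (here refl) x∈ys → All.lookup (All.++⁻ʳ xs x∉) x∈ys refl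
    ; (there x∈xs)     → disjoint x∈xs }

!-mono-≤ : ∀ {m n} → m ≤ n → m ! ≤ n !
!-mono-≤ {n = n} z≤n = ℕ.1≤n! n
!-mono-≤ (s≤s m≤n)   = ℕ.*-mono-≤ (s≤s m≤n) (!-mono-≤ m≤n)

-- Independent sets

module _ (e : Fin ℓ → Fin n) where

  extend : (Fin ℓ → Fin ℓ) → Fin n → Fin n
  extend f y with Fin.any? (λ i → e i ≟ y)
  ... | yes (i , _) = e (f i)
  ... | no _        = y

  extend-out : ∀ f {y} → (∀ i → e i ≢ y) → extend f y ≡ y
  extend-out f {y} y∉ with Fin.any? (λ i → e i ≟ y)
  ... | yes (i , eq) = contradiction eq (y∉ i)
  ... | no _         = refl

  module _ (e-inj : ∀ {i j} → e i ≡ e j → i ≡ j) where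

    extend-in : ∀ f i → extend f (e i) ≡ e (f i)
    extend-in f i with Fin.any? (λ j → e j ≟ e i)
    ... | yes (j , eq) = cong (e ∘ f) (e-inj eq)
    ... | no ¬p        = contradiction (i , refl) ¬p

    extend-inverse : ∀ f g → (∀ i → f (g i) ≡ i) → ∀ y → extend f (extend g y) ≡ y
    extend-inverse f g fg y with Fin.any? (λ i → e i ≟ y)
    ... | yes (i , refl) = trans (extend-in f (g i)) (cong e (fg i))
    ... | no ¬p          = extend-out f (λ i eq → ¬p (i , eq))

    extendPerm : Permutation′ ℓ → Permutation′ n
    extendPerm π = permutation (extend (π ⟨$⟩ʳ_)) (extend (π ⟨$⟩ˡ_))
      (extend-inverse _ _ (λ _ → inverseʳ π))
      (extend-inverse _ _ (λ _ → inverseˡ π))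

-- A factorial-base code: the leading digit is the image of `zero`, the other digits code the
-- permutation that remains. It supplies `ℓ !` distinct permutations for the pigeonhole principle.
decode : ∀ ℓ → Fin (ℓ !) → Permutation′ ℓ
decode zero    _ = id
decode (suc ℓ) c = insert zero (proj₁ ic) (decode ℓ (proj₂ ic))
  where
  ic : Fin (suc ℓ) × Fin (ℓ !)
  ic = remQuot (ℓ !) c

insert-injective : ∀ {i j} {π ρ : Permutation′ ℓ} → insert zero i π ≈ insert zero j ρ → i ≡ j × π ≈ ρ
insert-injective {i = i} {j} {π} {ρ} eq = i≡j , λ k → Fin.punchIn-injective i _ _ (begin
  punchIn i (π ⟨$⟩ʳ k)                ≡⟨ insert-punchIn zero i π k ⟨
  insert zero i π ⟨$⟩ʳ suc k          ≡⟨ eq (suc k) ⟩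
  insert zero j ρ ⟨$⟩ʳ suc k          ≡⟨ insert-punchIn zero j ρ k ⟩
  punchIn j (ρ ⟨$⟩ʳ k)                ≡⟨ cong (λ l → punchIn l (ρ ⟨$⟩ʳ k)) i≡j ⟨
  punchIn i (ρ ⟨$⟩ʳ k)                ∎)
  where
  open ≡-Reasoning
  i≡j : i ≡ j
  i≡j = eq zero

decode-injective : ∀ ℓ {c d} → decode ℓ c ≈ decode ℓ d → c ≡ d
decode-injective zero    {zero} {zero} _ = refl
decode-injective (suc ℓ) {c}    {d}    eq = begin
  c                                              ≡⟨ Fin.combine-remQuot {suc ℓ} (ℓ !) c ⟨
  combine (proj₁ ic) (proj₂ ic)                  ≡⟨ cong₂ combine (proj₁ both) (decode-injective ℓ (proj₂ both)) ⟩
  combine (proj₁ jd) (proj₂ jd)                ≡⟨ Fin.combine-remQuot {suc ℓ} (ℓ !) d ⟩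
  d                                              ∎
  where
  open ≡-Reasoning
  ic jd : Fin (suc ℓ) × Fin (ℓ !)
  ic  = remQuot (ℓ !) c
  jd = remQuot (ℓ !) d
  both : proj₁ ic ≡ proj₁ jd × decode ℓ (proj₂ ic) ≈ decode ℓ (proj₂ jd)
  both = insert-injective {π = decode ℓ (proj₂ ic)} {ρ = decode ℓ (proj₂ jd)} eq

SupportedIn : List (Fin n) → Permutation′ n → Set
SupportedIn Γ g = ∀ y → y ∉ Γ → g ⟨$⟩ʳ y ≡ y

module _ (G : Permutation′ n → Set) where

  Independent : List (Fin n) → Set
  Independent Γ = ∀ g → G g → SupportedIn Γ g → ∀ y → g ⟨$⟩ʳ y ≡ y

  -- The obstruction to adding `x` to `Γ`: if `Γ` is independent and there is no such element of
  -- `G`, then `x ∷ Γ` is independent as well.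
  Dependent : List (Fin n) → Fin n → Set
  Dependent Γ x = Σ (Permutation′ n) λ g → G g × g ⟨$⟩ʳ x ≢ x × SupportedIn (x ∷ Γ) g

  -- Two permutations of `Γ` in one coset differ by an element of `G` supported in `Γ`, which is the
  -- identity. Hence the `length Γ !` permutations occupy distinct cosets.
  independent-!≤index : IsSubgroup G → ∀ {Γ m} → Unique Γ → Independent Γ → IndexAtMost G m → length Γ ! ≤ m
  independent-!≤index isG {Γ} {m} uΓ ind (reps , cover) = ℕ.≮⇒≥ λ m<ℓ! →
    let c , d , c<d , same = Fin.pigeonhole m<ℓ! coset
    in Fin.<⇒≢ c<d (decode-injective (length Γ) (collide c d same))
    where
    open IsSubgroup isG
    e : Fin (length Γ) → Fin n
    e = lookup Γ
    e-inj : ∀ {i j} → e i ≡ e j → i ≡ j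
    e-inj = lookup-injective uΓ
    π : Fin (length Γ !) → Permutation′ n
    π c = extendPerm e e-inj (decode (length Γ) c)
    coset : Fin (length Γ !) → Fin m
    coset c = proj₁ (cover (π c))
    collide : ∀ c d → coset c ≡ coset d → decode (length Γ) c ≈ decode (length Γ) d
    collide c d same i = e-inj (begin
      e (decode (length Γ) c ⟨$⟩ʳ i)             ≡⟨ extend-in e e-inj _ i ⟨
      π c ⟨$⟩ʳ e i                               ≡⟨ inverseʳ (π d) ⟨
      π d ⟨$⟩ʳ (π d ⟨$⟩ˡ (π c ⟨$⟩ʳ e i))         ≡⟨ cong (π d ⟨$⟩ʳ_) (ind g g∈G g-supp (e i)) ⟩
      π d ⟨$⟩ʳ e i                               ≡⟨ extend-in e e-inj _ i ⟩
      e (decode (length Γ) d ⟨$⟩ʳ i)             ∎)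
      where
      open ≡-Reasoning
      ρ : Permutation′ n
      ρ = Vec.lookup reps (coset d)
      g : Permutation′ n
      g = π c ∘ₚ flip (π d)
      g∈G : G g
      -- The common representative cancels: right to left, π_d⁻¹ π_c = (π_d⁻¹ ρ)(ρ⁻¹ π_c).
      g∈G = respects (λ y → cong (π d ⟨$⟩ˡ_) (inverseʳ ρ))
              (closed-∘ (subst (λ k → G (π c ∘ₚ flip (Vec.lookup reps k))) same (proj₂ (cover (π c))))
                        (closed-⁻¹ (proj₂ (cover (π d)))))
      g-supp : SupportedIn Γ g
      g-supp y y∉Γ = trans (cong (π d ⟨$⟩ˡ_) (extend-out e _ y∉)) (extend-out e _ y∉)
        where
        y∉ : ∀ i → e i ≢ y
        y∉ i eq = y∉Γ (subst (_∈ Γ) eq (∈-lookup i))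

  -- The case distinction on Dependent Γ x is classical, hence the double negation.
  greedy : ∀ L → ¬ ¬ (∃₂ λ Γ R → (L ↭ Γ ++ R) × Independent Γ × All (Dependent Γ) R)
  greedy []      K = K ([] , [] , ↭-refl , (λ g _ supp y → supp y (λ ())) , [])
  greedy (x ∷ L) K = greedy L λ (Γ , R , L↭ , ind , deps) →
    let accept : ¬ Dependent Γ x → ⊥
        accept ¬dep = K (x ∷ Γ , R , prep x L↭ , ind′ ind ¬dep , All.map weaken deps)
    in accept λ dep → K (Γ , x ∷ R , ↭-trans (prep x L↭) (↭-sym (shift x Γ R)) , ind , dep ∷ deps)
    where
    ind′ : ∀ {Γ} → Independent Γ → ¬ Dependent Γ x → Independent (x ∷ Γ)
    ind′ {Γ} ind ¬dep g g∈G supp with g ⟨$⟩ʳ x ≟ x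
    ... | no gx≢x  = contradiction (g , g∈G , gx≢x , supp) ¬dep
    ... | yes gx≡x = ind g g∈G supp′
      where
      supp′ : SupportedIn Γ g
      supp′ y y∉Γ with y ≟ x
      ... | yes refl = gx≡x
      ... | no y≢x   = supp y λ { (here eq) → y≢x eq ; (there y∈Γ) → y∉Γ y∈Γ }
    -- Elements rejected earlier stay dependent when `Γ` grows, with the same witness.
    weaken : ∀ {Γ y} → Dependent Γ y → Dependent (x ∷ Γ) y
    weaken (g , g∈G , moves , supp) = g , g∈G , moves , λ y y∉ →
      supp y λ { (here eq) → y∉ (here eq) ; (there y∈) → y∉ (there (there y∈)) }

  -- The supports of the `g i` share only the core `x`; `petals` says so pairwise without forming
  -- the supports as sets. Confinement to `L` leaves room for another petal outside it.
  record Sunflower (d : ℕ) (L : List (Fin n)) : Set where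
    field
      x         : Fin n
      x∈L       : x ∈ L
      g         : Fin d → Permutation′ n
      g∈G       : ∀ i → G (g i)
      moves     : ∀ i → g i ⟨$⟩ʳ x ≢ x
      supported : ∀ i → SupportedIn L (g i)
      petals    : ∀ {i j} → i ≢ j → ∀ {y} → y ≢ x → g i ⟨$⟩ʳ y ≡ y ⊎ g j ⟨$⟩ʳ y ≡ y

  -- Induction on `d`. An independent `Γ` takes at most `ℓ` elements of `L`, so the rest `R` is long
  -- enough for `d` petals. Their core lies in `R`, hence depends on `Γ`, which gives one more petal
  -- inside `Γ` and the core.
  sunflower : IsSubgroup G → ∀ {m} ℓ → IndexAtMost G m → m < ℓ ! →
              ∀ d L → Unique L → d * ℓ < length L → ¬ ¬ Sunflower d L
  sunflower isG ℓ idx m<ℓ! zero (x ∷ L) uL _ K = K record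
    { x = x ; x∈L = here refl ; g = λ () ; g∈G = λ () ; moves = λ () ; supported = λ () ; petals = λ { {()} } }
  sunflower isG ℓ idx m<ℓ! (suc d) L uL lt K = greedy L step
    where
    step : ¬ (∃₂ λ Γ R → (L ↭ Γ ++ R) × Independent Γ × All (Dependent Γ) R)
    step (Γ , R , L↭ , ind , deps) = sunflower isG ℓ idx m<ℓ! d R uR |R| (K ∘ grow)
      where
      u : Unique (Γ ++ R)
      u = ↭ₛ.Unique-resp-↭ (setoid (Fin n)) (↭⇒↭ₛ L↭) uL
      uΓ : Unique Γ
      uΓ = proj₁ (Unique-++⁻ Γ u)
      uR : Unique R
      uR = proj₁ (proj₂ (Unique-++⁻ Γ u))
      |Γ| : length Γ ≤ ℓ
      |Γ| = ℕ.≮⇒≥ λ ℓ<|Γ| → ℕ.<⇒≱ m<ℓ!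
              (ℕ.≤-trans (!-mono-≤ (ℕ.<⇒≤ ℓ<|Γ|)) (independent-!≤index isG uΓ ind idx))
      |R| : d * ℓ < length R
      |R| = ℕ.+-cancelˡ-< (length Γ) _ _ (ℕ.≤-<-trans (ℕ.+-monoˡ-≤ (d * ℓ) |Γ|)
        (subst (ℓ + d * ℓ <_) (trans (↭-length L↭) (List.length-++ Γ)) lt))
      grow : Sunflower d R → Sunflower (suc d) L
      grow S = record
        { x = x
        ; x∈L = R⊆L x∈L
        ; g = g′
        ; g∈G = λ { zero → proj₁ (proj₂ dep) ; (suc i) → g∈G i }
        ; moves = λ { zero → proj₁ (proj₂ (proj₂ dep)) ; (suc i) → moves i }
        ; supported = λ
            { zero y y∉L → g₀-supp y λ
                { (here refl) → y∉L (R⊆L x∈L)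
                ; (there y∈Γ) → y∉L (∈-resp-↭ (↭-sym L↭) (∈-++⁺ˡ y∈Γ)) }
            ; (suc i) y y∉L → supported i y (y∉L ∘ R⊆L) }
        ; petals = petals′
        }
        where
        open Sunflower S
        R⊆L : ∀ {y} → y ∈ R → y ∈ L
        R⊆L y∈R = ∈-resp-↭ (↭-sym L↭) (∈-++⁺ʳ Γ y∈R)
        dep : Dependent Γ x
        dep = All.lookup deps x∈L
        g₀-supp : SupportedIn (x ∷ Γ) (proj₁ dep)
        g₀-supp = proj₂ (proj₂ (proj₂ dep))
        g′ : Fin (suc d) → Permutation′ n
        g′ zero    = proj₁ dep
        g′ (suc i) = g i
        -- `Γ` and `R` are disjoint: on `Γ` the old petals act trivially, and outside `Γ` the new
        -- one moves at most `x`.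
        first : ∀ i {y} → y ≢ x → g′ zero ⟨$⟩ʳ y ≡ y ⊎ g i ⟨$⟩ʳ y ≡ y
        first i {y} y≢x with y ∈? Γ
        ... | yes y∈Γ = inj₂ (supported i y (proj₂ (proj₂ (Unique-++⁻ Γ u)) y∈Γ))
        ... | no y∉Γ  = inj₁ (g₀-supp y λ { (here eq) → y≢x eq ; (there y∈Γ) → y∉Γ y∈Γ })
        petals′ : ∀ {i j} → i ≢ j → ∀ {y} → y ≢ x → g′ i ⟨$⟩ʳ y ≡ y ⊎ g′ j ⟨$⟩ʳ y ≡ y
        petals′ {zero}  {zero}  i≢j = contradiction refl i≢j
        petals′ {zero}  {suc j} _   = first j
        petals′ {suc i} {zero}  _   = swap ∘ first i
        petals′ {suc i} {suc j} i≢j = petals (i≢j ∘ cong suc)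

-- Three-cycles

IsThreeCycle : Fin n → Fin n → Fin n → Permutation′ n → Set
IsThreeCycle p q r g =
  g ⟨$⟩ʳ p ≡ q × g ⟨$⟩ʳ q ≡ r × g ⟨$⟩ʳ r ≡ p ×
  (∀ y → y ≢ p → y ≢ q → y ≢ r → g ⟨$⟩ʳ y ≡ y)

⟨$⟩ˡ-from : (π : Permutation′ n) → ∀ {x y} → π ⟨$⟩ʳ x ≡ y → π ⟨$⟩ˡ y ≡ x
⟨$⟩ˡ-from π refl = inverseˡ π

module _ (g h : Permutation′ n) where

  -- Written from right to left, this is g h g⁻¹ h⁻¹.
  commutator : Permutation′ n
  commutator = (flip h ∘ₚ flip g) ∘ₚ (h ∘ₚ g)

  commutator-path : ∀ {y u v w z} → h ⟨$⟩ʳ u ≡ y → g ⟨$⟩ʳ v ≡ u → h ⟨$⟩ʳ v ≡ w → g ⟨$⟩ʳ w ≡ z →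
                    commutator ⟨$⟩ʳ y ≡ z
  commutator-path {y} {u} {v} {w} {z} hu gv hv gw = begin
    g ⟨$⟩ʳ (h ⟨$⟩ʳ (g ⟨$⟩ˡ (h ⟨$⟩ˡ y)))  ≡⟨ cong (λ a → g ⟨$⟩ʳ (h ⟨$⟩ʳ (g ⟨$⟩ˡ a))) (⟨$⟩ˡ-from h hu) ⟩
    g ⟨$⟩ʳ (h ⟨$⟩ʳ (g ⟨$⟩ˡ u))           ≡⟨ cong (λ a → g ⟨$⟩ʳ (h ⟨$⟩ʳ a)) (⟨$⟩ˡ-from g gv) ⟩
    g ⟨$⟩ʳ (h ⟨$⟩ʳ v)                    ≡⟨ cong (g ⟨$⟩ʳ_) hv ⟩
    g ⟨$⟩ʳ w                             ≡⟨ gw ⟩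
    z                                    ∎
    where open ≡-Reasoning

module _ (g h : Permutation′ n) {x} (gx≢x : g ⟨$⟩ʳ x ≢ x) (hx≢x : h ⟨$⟩ʳ x ≢ x)
         (petals : ∀ {y} → y ≢ x → g ⟨$⟩ʳ y ≡ y ⊎ h ⟨$⟩ʳ y ≡ y) where

  private
    g-moved : ∀ {y} → y ≢ x → g ⟨$⟩ʳ y ≢ y → h ⟨$⟩ʳ y ≡ y
    g-moved y≢x gy≢y with petals y≢x
    ... | inj₁ gy≡y = contradiction gy≡y gy≢y
    ... | inj₂ hy≡y = hy≡y

    h-moved : ∀ {y} → y ≢ x → h ⟨$⟩ʳ y ≢ y → g ⟨$⟩ʳ y ≡ y
    h-moved y≢x hy≢y with petals y≢x
    ... | inj₁ gy≡y = gy≡y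
    ... | inj₂ hy≡y = contradiction hy≡y hy≢y

  -- `g` moves g x and `h` moves h x, so a common image would be a point other than `x` moved by
  -- both.
  image≢ : g ⟨$⟩ʳ x ≢ h ⟨$⟩ʳ x
  image≢ eq with petals gx≢x
  ... | inj₁ ga≡a = gx≢x (⟨$⟩ʳ-injective g ga≡a)
  ... | inj₂ ha≡a = gx≢x (⟨$⟩ʳ-injective h (trans ha≡a eq))

  commutator-threeCycle : IsThreeCycle x (g ⟨$⟩ʳ x) (h ⟨$⟩ʳ x) (commutator g h)
  commutator-threeCycle =
      -- Put a = g x, b = h x, a′ = g⁻¹ x, b′ = h⁻¹ x. Under h⁻¹, g⁻¹, h, g in turn the three paths
      -- are x b′ b′ x a, then a a x b b, then b x a′ a′ x.
      commutator-path g h (inverseʳ h) b′-fixed (inverseʳ h) refl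
    , commutator-path g h (g-moved gx≢x (gx≢x ∘ ⟨$⟩ʳ-injective g)) refl refl
                          (h-moved hx≢x (hx≢x ∘ ⟨$⟩ʳ-injective h))
    , commutator-path g h refl (inverseʳ g) a′-fixed (inverseʳ g)
    , rest
    where
    x≢preimage : (π : Permutation′ n) → π ⟨$⟩ʳ x ≢ x → π ⟨$⟩ˡ x ≢ x
    x≢preimage π πx≢x eq = πx≢x (trans (cong (π ⟨$⟩ʳ_) (sym eq)) (inverseʳ π))
    b′-fixed : g ⟨$⟩ʳ (h ⟨$⟩ˡ x) ≡ h ⟨$⟩ˡ x
    b′-fixed = h-moved (x≢preimage h hx≢x) λ eq → x≢preimage h hx≢x (trans (sym eq) (inverseʳ h))
    a′-fixed : h ⟨$⟩ʳ (g ⟨$⟩ˡ x) ≡ g ⟨$⟩ˡ x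
    a′-fixed = g-moved (x≢preimage g gx≢x) λ eq → x≢preimage g gx≢x (trans (sym eq) (inverseʳ g))
    rest : ∀ y → y ≢ x → y ≢ g ⟨$⟩ʳ x → y ≢ h ⟨$⟩ʳ x → commutator g h ⟨$⟩ʳ y ≡ y
    rest y y≢x y≢a y≢b with petals y≢x
    ... | inj₁ gy≡y = commutator-path g h (inverseʳ h) gu≡u (inverseʳ h) gy≡y
      where
      u≢x : h ⟨$⟩ˡ y ≢ x
      u≢x eq = y≢b (trans (sym (inverseʳ h)) (cong (h ⟨$⟩ʳ_) eq))
      gu≡u : g ⟨$⟩ʳ (h ⟨$⟩ˡ y) ≡ h ⟨$⟩ˡ y
      -- If `h` fixes h⁻¹ y, then this point is `y` itself, which `g` fixes.
      gu≡u with petals u≢x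
      ... | inj₁ eq = eq
      ... | inj₂ eq = subst (λ u → g ⟨$⟩ʳ u ≡ u) (trans (sym (inverseʳ h)) eq) gy≡y
    ... | inj₂ hy≡y = commutator-path g h hy≡y (inverseʳ g) hv≡v (inverseʳ g)
      where
      v≢x : g ⟨$⟩ˡ y ≢ x
      v≢x eq = y≢a (trans (sym (inverseʳ g)) (cong (g ⟨$⟩ʳ_) eq))
      hv≡v : h ⟨$⟩ʳ (g ⟨$⟩ˡ y) ≡ g ⟨$⟩ˡ y
      hv≡v with petals v≢x
      ... | inj₁ eq = subst (λ u → h ⟨$⟩ʳ u ≡ u) (trans (sym (inverseʳ g)) eq) hy≡y
      ... | inj₂ eq = eq

rotate : ∀ {p q r} {g : Permutation′ n} → IsThreeCycle p q r g → IsThreeCycle q r p g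
rotate (gp , gq , gr , out) = gq , gr , gp , λ y y≢q y≢r y≢p → out y y≢p y≢q y≢r

-- Following (x a b) by (x c a) returns `x` to itself and leaves (a b c). This yields the
-- three-cycles that avoid a common point `x`.
threeCycle-∘ : ∀ {x a b c} {g h : Permutation′ n} →
               x ≢ b → x ≢ c → a ≢ b → a ≢ c → b ≢ c →
               IsThreeCycle x a b g → IsThreeCycle x c a h → IsThreeCycle a b c (g ∘ₚ h)
threeCycle-∘ {x = x} {g = g} {h} x≢b x≢c a≢b a≢c b≢c (gx , ga , gb , g-out) (hx , hc , ha , h-out) =
    trans (cong (h ⟨$⟩ʳ_) ga) (h-out _ (x≢b ∘ sym) b≢c (a≢b ∘ sym))
  , trans (cong (h ⟨$⟩ʳ_) gb) hx
  , trans (cong (h ⟨$⟩ʳ_) (g-out _ (x≢c ∘ sym) (a≢c ∘ sym) (b≢c ∘ sym))) hc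
  , rest
  where
  rest : ∀ y → y ≢ _ → y ≢ _ → y ≢ _ → (g ∘ₚ h) ⟨$⟩ʳ y ≡ y
  rest y y≢a y≢b y≢c with y ≟ x
  ... | yes refl = trans (cong (h ⟨$⟩ʳ_) gx) ha
  ... | no y≢x   = trans (cong (h ⟨$⟩ʳ_) (g-out y y≢x y≢a y≢b)) (h-out y y≢x y≢c y≢a)

-- Even permutations of five points

Triple : ℕ → Set
Triple n = Fin n × Fin n × Fin n

cycle : ∀ {n} → Triple n → Fin n → Fin n
cycle (p , q , r) y =
  if does (y ≟ p) then q else if does (y ≟ q) then r else if does (y ≟ r) then p else y

eval : ∀ {n} → List (Triple n) → Fin n → Fin n
eval []      i = i
eval (c ∷ w) i = cycle c (eval w i)

Distinct : ∀ {n} → Triple n → Set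
Distinct (p , q , r) = p ≢ q × q ≢ r × r ≢ p

distinct? : ∀ {n} (c : Triple n) → Dec (Distinct c)
distinct? (p , q , r) = ¬? (p ≟ q) ×-dec ¬? (q ≟ r) ×-dec ¬? (r ≟ p)

inversions : ∀ {n} → (Fin n → Fin n) → ℕ
inversions {n} f = length (filter (λ ij → (proj₁ ij <? proj₂ ij) ×-dec (f (proj₂ ij) <? f (proj₁ ij)))
                                  (cartesianProduct (allFin n) (allFin n)))

-- A three-cycle c with c i ≡ f i that fixes every j < i, provided i < 3 and f fixes
-- every j < i. Removing such cycles for i = 0, 1, 2 leaves the identity or the
-- transposition of 3 and 4, and the latter is odd.
fixing : Fin 5 → (Fin 5 → Fin 5) → List (Triple 5)
fixing i f = if does (f i ≟ i) then [] else (i , f i , (if does (f i ≟ 4F) then 3F else 4F)) ∷ []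

-- A reversed triple is the inverse three-cycle. It is composed on the left of `f`, matching `eval`,
-- where the head of a word acts last.
undo : List (Triple 5) → (Fin 5 → Fin 5) → Fin 5 → Fin 5
undo []                f i = f i
undo ((p , q , r) ∷ w) f i = undo w (λ j → cycle (r , q , p) (f j)) i

factor : List (Fin 5) → Vec (Fin 5) 5 → List (Triple 5)
factor []       v = []
factor (i ∷ is) v = c ++ factor is (Vec.tabulate (undo c (Vec.lookup v)))
  where
  c : List (Triple 5)
  c = fixing i (Vec.lookup v)

word : Vec (Fin 5) 5 → List (Triple 5)
word = factor (0F ∷ 1F ∷ 2F ∷ [])

-- Maps are given by vectors of values, so that ranging over all of them amounts to five finite
-- quantifiers.
FactorsIfEven : Vec (Fin 5) 5 → Set
FactorsIfEven v =
  (∀ i j → Vec.lookup v i ≡ Vec.lookup v j → i ≡ j) → 2 ∣ inversions (Vec.lookup v) →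
  All Distinct (word v) × (∀ i → eval (word v) i ≡ Vec.lookup v i)

factorsIfEven? : ∀ v → Dec (FactorsIfEven v)
factorsIfEven? v =
  Fin.all? (λ i → Fin.all? λ j → (Vec.lookup v i ≟ Vec.lookup v j) →-dec (i ≟ j)) →-dec
  (2 ∣? inversions (Vec.lookup v)) →-dec
  (All.all? distinct? (word v) ×-dec Fin.all? λ i → eval (word v) i ≟ Vec.lookup v i)

-- Settled by evaluation on all 5^5 = 3125 vectors; those that are not injective or not even pass
-- vacuously. It shows that three-cycles generate the alternating group on five points.
allFactorIfEven : ∀ a b c d e → FactorsIfEven (a ∷ b ∷ c ∷ d ∷ e ∷ [])
allFactorIfEven = toWitness
  {a? = Fin.all? λ a → Fin.all? λ b → Fin.all? λ c → Fin.all? λ d → Fin.all? λ e →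
          factorsIfEven? (a ∷ b ∷ c ∷ d ∷ e ∷ [])} _

even⇒word : ∀ v → FactorsIfEven v
even⇒word (a ∷ b ∷ c ∷ d ∷ e ∷ []) = allFactorIfEven a b c d e

-- Parts of a partition

-- The length is a variable `m`, so that a part known to have five points is indexed by `Fin 5`
-- itself.
enumerate : ∀ {A : Set} {R : A → A → Set} {xs : List A} {m} → AllPairs R xs → length xs ≡ m →
            Σ (Fin m → A) λ s → (∀ {i j} → i <ᶠ j → R (s i) (s j)) ×
              (∀ i → s i ∈ xs) × (∀ {y} → y ∈ xs → ∃[ i ] y ≡ s i)
enumerate {xs = xs} rs refl = lookup xs , lookup-<⁺ rs , ∈-lookup , λ y∈ → index y∈ , Any.lookup-index y∈

<-embedding-injective : ∀ {m} {s : Fin m → Fin n} → (∀ {i j} → i <ᶠ j → s i <ᶠ s j) →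
                        ∀ {i j} → s i ≡ s j → i ≡ j
<-embedding-injective s-mono {i} {j} eq with Fin.<-cmp i j
... | tri< i<j _ _ = contradiction eq (Fin.<⇒≢ (s-mono i<j))
... | tri≈ _ i≡j _ = i≡j
... | tri> _ _ j<i = contradiction (sym eq) (Fin.<⇒≢ (s-mono j<i))

<-embedding-cancel : ∀ {m} {s : Fin m → Fin n} → (∀ {i j} → i <ᶠ j → s i <ᶠ s j) →
                     ∀ {i j} → s i <ᶠ s j → i <ᶠ j
<-embedding-cancel s-mono {i} {j} lt with Fin.<-cmp i j
... | tri< i<j _ _  = i<j
... | tri≈ _ refl _ = contradiction lt (Fin.<-irrefl refl)
... | tri> _ _ j<i  = contradiction (s-mono j<i) (Fin.<-asym lt)

-- `s` preserves and reflects the order, so it matches the inversions of `f` with those of `π`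
-- inside the part. Both lists are duplicate-free, and inclusion in both directions equates their
-- lengths. Parity thus passes from `Fin n` to the index set.
inversionsIn-embedding : ∀ {m} (P : Partition n) x (s : Fin m → Fin n) →
  (∀ {i j} → i <ᶠ j → s i <ᶠ s j) →
  (∀ i → P (s i) ≡ P x) → (∀ {y} → P y ≡ P x → ∃[ i ] y ≡ s i) →
  ∀ π f → (∀ i → π ⟨$⟩ʳ s i ≡ s (f i)) → inversionsIn P x π ≡ inversions f
inversionsIn-embedding {n} {m} P x s s-mono s-in s-onto π f π-in = trans
  (ℕ.≤-antisym
    (Unique-⊆-length (Unique.filter⁺ inPart? (Unique.cartesianProduct⁺ (Unique.allFin⁺ n) (Unique.allFin⁺ n))) to)
    (Unique-⊆-length (Unique.map⁺ ss-injective
       (Unique.filter⁺ inverted? (Unique.cartesianProduct⁺ (Unique.allFin⁺ m) (Unique.allFin⁺ m)))) from))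
  (List.length-map ss (filter inverted? (cartesianProduct (allFin m) (allFin m))))
  where
  inPart? = λ (ij : Fin n × Fin n) →
    ((P (proj₁ ij) ≟ P x) ×-dec (P (proj₂ ij) ≟ P x))
    ×-dec ((proj₁ ij <? proj₂ ij) ×-dec ((π ⟨$⟩ʳ proj₂ ij) <? (π ⟨$⟩ʳ proj₁ ij)))
  inverted? = λ (ij : Fin m × Fin m) → (proj₁ ij <? proj₂ ij) ×-dec (f (proj₂ ij) <? f (proj₁ ij))
  ss : Fin m × Fin m → Fin n × Fin n
  ss (i , j) = s i , s j
  ss-injective : ∀ {a b} → ss a ≡ ss b → a ≡ b
  ss-injective e = cong₂ _,_ (<-embedding-injective s-mono (cong proj₁ e)) (<-embedding-injective s-mono (cong proj₂ e))
  to : ∀ {ij} → ij ∈ filter inPart? (cartesianProduct (allFin n) (allFin n)) →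
       ij ∈ map ss (filter inverted? (cartesianProduct (allFin m) (allFin m)))
  to ij∈ with ∈-filter⁻ inPart? {xs = cartesianProduct (allFin n) (allFin n)} ij∈
  ... | _ , (ei , ej) , lt , gt with s-onto ei | s-onto ej
  ... | i , refl | j , refl = ∈-map⁺ ss (∈-filter⁺ inverted? (∈-cartesianProduct⁺ (∈-allFin i) (∈-allFin j))
    (<-embedding-cancel s-mono lt , <-embedding-cancel s-mono (subst₂ _<ᶠ_ (π-in j) (π-in i) gt)))
  from : ∀ {ij} → ij ∈ map ss (filter inverted? (cartesianProduct (allFin m) (allFin m))) →
         ij ∈ filter inPart? (cartesianProduct (allFin n) (allFin n))
  from ij∈ with ∈-map⁻ ss ij∈
  ... | (i , j) , ij∈′ , refl with ∈-filter⁻ inverted? {xs = cartesianProduct (allFin m) (allFin m)} ij∈′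
  ... | _ , lt , gt = ∈-filter⁺ inPart? (∈-cartesianProduct⁺ (∈-allFin (s i)) (∈-allFin (s j)))
    ((s-in i , s-in j) , s-mono lt , subst₂ _<ᶠ_ (sym (π-in j)) (sym (π-in i)) (s-mono gt))

module Merge {m} (t : Fin (suc m) → Fin n) where

  -- Points off the range of `t` label themselves; as `t zero` lies in the range, they become
  -- singletons.
  merge : Partition n
  merge y with Fin.any? (λ i → t i ≟ y)
  ... | yes _ = t zero
  ... | no _  = y

  merge-in : ∀ i → merge (t i) ≡ t zero
  merge-in i with Fin.any? (λ j → t j ≟ t i)
  ... | yes _ = refl
  ... | no ¬p = contradiction (i , refl) ¬p

  merge-out : ∀ {y} → (∀ i → t i ≢ y) → merge y ≡ y
  merge-out {y} y∉ with Fin.any? (λ j → t j ≟ y)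
  ... | yes (j , eq) = contradiction eq (y∉ j)
  ... | no _         = refl

  merge-part : ∀ i → merge (t i) ≡ merge (t zero)
  merge-part i = trans (merge-in i) (sym (merge-in zero))

  merge-in⁻ : ∀ {y} → merge y ≡ merge (t zero) → ∃[ i ] t i ≡ y
  merge-in⁻ {y} eq with Fin.any? (λ j → t j ≟ y)
  ... | yes p = p
  -- A point off the range with this label would be `t zero`, so the index `zero` serves.
  ... | no _  = zero , trans (sym (merge-in zero)) (sym eq)

  module _ (t-inj : ∀ {i j} → t i ≡ t j → i ≡ j) where

    private
      inPart? : ∀ y → Dec (merge y ≡ merge (t zero))
      inPart? y = merge y ≟ merge (t zero)

    partSize-merge : partSize merge (t zero) ≡ suc m
    partSize-merge = trans
      (ℕ.≤-antisym
        (Unique-⊆-length (Unique.filter⁺ inPart? (Unique.allFin⁺ n))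
           (λ y∈ → let i , eq = merge-in⁻ (proj₂ (∈-filter⁻ inPart? {xs = allFin n} y∈))
                   in subst (_∈ tabulate t) eq (∈-tabulate⁺ {f = t} i)))
        (Unique-⊆-length (Unique.tabulate⁺ t-inj)
           (λ {y} y∈ → let i , eq = ∈-tabulate⁻ {f = t} y∈
                       in ∈-filter⁺ inPart? (∈-allFin y) (trans (cong merge eq) (merge-part i)))))
      (List.length-tabulate t)

    abstract

      -- Inversions refer to the order of `Fin n`, but `t` need not be increasing, so the part is
      -- listed afresh in increasing order.
      enumeratePart : Σ (Fin (suc m) → Fin n) λ s → (∀ {i j} → i <ᶠ j → s i <ᶠ s j) ×
                        (∀ i → merge (s i) ≡ merge (t zero)) ×
                        (∀ {y} → merge y ≡ merge (t zero) → ∃[ i ] y ≡ s i)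
      enumeratePart =
        let s , s-mono , s∈ , onto = enumerate sorted partSize-merge
        in s , s-mono , (λ i → proj₂ (∈-filter⁻ inPart? {xs = allFin n} (s∈ i)))
             , (λ {y} eq → onto (∈-filter⁺ inPart? (∈-allFin y) eq))
        where
        sorted : AllPairs _<ᶠ_ (filter inPart? (allFin n))
        sorted = AllPairs.filter⁺ inPart? (AllPairs.tabulate⁺-< {f = λ i → i} (λ i<j → i<j))

-- From three-cycles in `G` to an alternating supporting partition.

module _ (G : Permutation′ n → Set) (isG : IsSubgroup G) where

  open IsSubgroup isG

  HasThreeCycle : Fin n → Fin n → Fin n → Set
  HasThreeCycle p q r = Σ (Permutation′ n) λ g → G g × IsThreeCycle p q r g

  -- A triple through the hub `t zero` is a rotation of a given one; a triple avoiding it comes from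
  -- two three-cycles through the hub by `threeCycle-∘`.
  hub⇒all : ∀ {m} (t : Fin (suc m) → Fin n) → (∀ {i j} → t i ≡ t j → i ≡ j) →
            (∀ {i j} → i ≢ j → HasThreeCycle (t zero) (t (suc i)) (t (suc j))) →
            ∀ p q r → Distinct (p , q , r) → HasThreeCycle (t p) (t q) (t r)
  hub⇒all t t-inj hub p q r (p≢q , q≢r , r≢p) = go p q r p≢q q≢r r≢p
    where
    rot : ∀ {p q r} → HasThreeCycle p q r → HasThreeCycle q r p
    rot (g , g∈G , c) = g , g∈G , rotate {g = g} c
    go : ∀ p q r → p ≢ q → q ≢ r → r ≢ p → HasThreeCycle (t p) (t q) (t r)
    go zero    zero    r       p≢q q≢r r≢p = contradiction refl p≢q
    go zero    (suc q) zero    p≢q q≢r r≢p = contradiction refl r≢p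
    go (suc p) zero    zero    p≢q q≢r r≢p = contradiction refl q≢r
    go zero    (suc q) (suc r) p≢q q≢r r≢p = hub (q≢r ∘ cong suc)
    go (suc p) zero    (suc r) p≢q q≢r r≢p = rot (rot (hub (r≢p ∘ cong suc)))
    go (suc p) (suc q) zero    p≢q q≢r r≢p = rot (hub (p≢q ∘ cong suc))
    go (suc p) (suc q) (suc r) p≢q q≢r r≢p =
      let g , g∈G , gc = hub (p≢q ∘ cong suc)
          h , h∈G , hc = hub (r≢p ∘ cong suc)
      in g ∘ₚ h , closed-∘ g∈G h∈G ,
         threeCycle-∘ {g = g} {h} (Fin.0≢1+n ∘ t-inj) (Fin.0≢1+n ∘ t-inj)
           (p≢q ∘ t-inj) (r≢p ∘ sym ∘ t-inj) (q≢r ∘ t-inj) gc hc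

  module _ {m} (s : Fin m → Fin n) (s-inj : ∀ {i j} → s i ≡ s j → i ≡ j)
           (threeCycles : ∀ p q r → Distinct (p , q , r) → HasThreeCycle (s p) (s q) (s r)) where

    Acts : (Fin m → Fin m) → Permutation′ n → Set
    Acts f g = (∀ i → g ⟨$⟩ʳ s i ≡ s (f i)) × (∀ y → (∀ i → y ≢ s i) → g ⟨$⟩ʳ y ≡ y)

    cycle-acts : ∀ c → Distinct c → Σ (Permutation′ n) λ g → G g × Acts (cycle c) g
    cycle-acts (p , q , r) distinct with g , g∈G , gp , gq , gr , out ← threeCycles p q r distinct =
      g , g∈G , acts , λ y y∉ → out y (y∉ p) (y∉ q) (y∉ r)
      where
      acts : ∀ i → g ⟨$⟩ʳ s i ≡ s (cycle (p , q , r) i)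
      acts i with i ≟ p
      ... | yes refl = gp
      ... | no i≢p with i ≟ q
      ... | yes refl = gq
      ... | no i≢q with i ≟ r
      ... | yes refl = gr
      ... | no i≢r = out (s i) (i≢p ∘ s-inj) (i≢q ∘ s-inj) (i≢r ∘ s-inj)

    word-acts : ∀ w → All Distinct w → Σ (Permutation′ n) λ g → G g × Acts (eval w) g
    word-acts []      []        = id , has-id , (λ i → refl) , λ y _ → refl
    word-acts (c ∷ w) (dc ∷ dw) =
      let g , g∈G , g-in , g-out = word-acts w dw
          h , h∈G , h-in , h-out = cycle-acts c dc
      in g ∘ₚ h , closed-∘ g∈G h∈G
       , (λ i → trans (cong (h ⟨$⟩ʳ_) (g-in i)) (h-in (eval w i)))
       , (λ y y∉ → trans (cong (h ⟨$⟩ʳ_) (g-out y y∉)) (h-out y y∉))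

  module _ (t : Fin 5 → Fin n) (t-inj : ∀ {i j} → t i ≡ t j → i ≡ j)
           (threeCycles : ∀ p q r → Distinct (p , q , r) → HasThreeCycle (t p) (t q) (t r)) where

    open Merge t

    private
      s : Fin 5 → Fin n
      s = proj₁ (enumeratePart t-inj)

      s-mono : ∀ {i j} → i <ᶠ j → s i <ᶠ s j
      s-mono = proj₁ (proj₂ (enumeratePart t-inj))

      s∈part : ∀ i → merge (s i) ≡ merge (t zero)
      s∈part = proj₁ (proj₂ (proj₂ (enumeratePart t-inj)))

      s-onto : ∀ {y} → merge y ≡ merge (t zero) → ∃[ i ] y ≡ s i
      s-onto = proj₂ (proj₂ (proj₂ (enumeratePart t-inj)))

      s-inj : ∀ {i j} → s i ≡ s j → i ≡ j
      s-inj = <-embedding-injective s-mono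

      s-threeCycles : ∀ p q r → Distinct (p , q , r) → HasThreeCycle (s p) (s q) (s r)
      s-threeCycles p q r (p≢q , q≢r , r≢p) =
        let p′ , ep = merge-in⁻ (s∈part p)
            q′ , eq = merge-in⁻ (s∈part q)
            r′ , er = merge-in⁻ (s∈part r)
        in transport ep eq er (threeCycles p′ q′ r′
             ( (λ e → p≢q (s-inj (trans (sym ep) (trans (cong t e) eq))))
             , (λ e → q≢r (s-inj (trans (sym eq) (trans (cong t e) er))))
             , (λ e → r≢p (s-inj (trans (sym er) (trans (cong t e) ep))))))
        where
        transport : ∀ {a b c a′ b′ c′} → a ≡ a′ → b ≡ b′ → c ≡ c′ →
                    HasThreeCycle a b c → HasThreeCycle a′ b′ c′
        transport refl refl refl h = h

    -- `π` restricts to an even permutation of the five-point part and fixes everything else. A word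
    -- in three-cycles gives an element of `G` with the same values.
    merge-isASP : IsASP G merge
    merge-isASP π (preserves , even) =
      let distinct , evaluates = even⇒word v v-inj v-even
          g , g∈G , g-in , g-out = word-acts s s-inj s-threeCycles (word v) distinct
          agree : ∀ y → g ⟨$⟩ʳ y ≡ π ⟨$⟩ʳ y
          agree y = case-part y
            (λ { (i , refl) → trans (g-in i) (trans (cong s (evaluates i)) (sym (π-in i))) })
            (λ y∉ → trans (g-out y y∉) (sym (π-out y y∉)))
      in respects agree g∈G
      where
      image : ∀ i → ∃[ j ] π ⟨$⟩ʳ s i ≡ s j
      image i = s-onto (trans (preserves (s i)) (s∈part i))
      v : Vec (Fin 5) 5
      v = Vec.tabulate (proj₁ ∘ image)
      π-in : ∀ i → π ⟨$⟩ʳ s i ≡ s (Vec.lookup v i)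
      π-in i = trans (proj₂ (image i)) (cong s (sym (Vec.lookup∘tabulate (proj₁ ∘ image) i)))
      v-inj : ∀ i j → Vec.lookup v i ≡ Vec.lookup v j → i ≡ j
      v-inj i j eq = s-inj (⟨$⟩ʳ-injective π (trans (π-in i) (trans (cong s eq) (sym (π-in j)))))
      v-even : 2 ∣ inversions (Vec.lookup v)
      v-even = subst (2 ∣_)
        (inversionsIn-embedding merge (t zero) s s-mono s∈part s-onto π (Vec.lookup v) π-in)
        -- The part has exactly five points, so it just reaches the size at which evenness is
        -- imposed.
        (even (t zero) (ℕ.≤-reflexive (sym (partSize-merge t-inj))))
      case-part : ∀ y {P : Set} → (∃[ i ] y ≡ s i → P) → ((∀ i → y ≢ s i) → P) → P
      case-part y f g with merge y ≟ merge (t zero)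
      ... | yes eq = f (s-onto eq)
      ... | no neq = g λ { i refl → neq (s∈part i) }
      -- Off the part every label is the point itself, so preserving labels means fixing points.
      π-out : ∀ y → (∀ i → y ≢ s i) → π ⟨$⟩ʳ y ≡ y
      π-out y y∉ = trans (sym (merge-out πy∉)) (trans (preserves y) (merge-out y∉t))
        where
        y∉t : ∀ i → t i ≢ y
        y∉t i eq = let j , eq′ = s-onto (trans (cong merge (sym eq)) (merge-part i)) in y∉ j eq′
        πy∉ : ∀ i → t i ≢ π ⟨$⟩ʳ y
        πy∉ i eq = let j , eq′ = s-onto (trans (sym (preserves y)) (trans (cong merge (sym eq)) (merge-part i))) in y∉ j eq′

  module _ {L : List (Fin n)} (S : Sunflower G 4 L) where

    open Sunflower S
    open Merge

    -- Why four petals: with the core they give five points, the least size at which a part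
    -- contributes Alt instead of Sym, and three-cycles generate only even permutations.
    points : Fin 5 → Fin n
    points zero    = x
    points (suc i) = g i ⟨$⟩ʳ x

    points-injective : ∀ {i j} → points i ≡ points j → i ≡ j
    points-injective {zero}  {zero}  _  = refl
    points-injective {zero}  {suc j} eq = contradiction (sym eq) (moves j)
    points-injective {suc i} {zero}  eq = contradiction eq (moves i)
    points-injective {suc i} {suc j} eq with i ≟ j
    ... | yes refl = refl
    ... | no i≢j   = contradiction eq (image≢ (g i) (g j) (moves i) (moves j) (petals i≢j))

    points-threeCycles : ∀ p q r → Distinct (p , q , r) → HasThreeCycle (points p) (points q) (points r)
    points-threeCycles = hub⇒all points points-injective λ {i} {j} i≢j →
      commutator (g i) (g j)
      , closed-∘ (closed-∘ (closed-⁻¹ (g∈G j)) (closed-⁻¹ (g∈G i))) (closed-∘ (g∈G j) (g∈G i))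
      , commutator-threeCycle (g i) (g j) (moves i) (moves j) (petals i≢j)

    -- The merged partition refines the coarsest one, so `x` shares its part there with a point that
    -- differs from it.
    sunflower⇒¬singleton : ∀ {P} → IsSPA G P → ¬ IsSingletonPart P x
    sunflower⇒¬singleton (_ , coarsest) single = moves 0F (single (points 1F)
      (coarsest (merge points) (merge-isASP points points-injective points-threeCycles) (points 1F) (points 0F)
        (merge-part points 1F)))

-- Subsets as duplicate-free lists.

elements : ∀ {n} → Subset n → List (Fin n)
elements []            = []
elements (inside ∷ Δ)  = zero ∷ map suc (elements Δ)
elements (outside ∷ Δ) = map suc (elements Δ)

length-elements : ∀ {n} (Δ : Subset n) → length (elements Δ) ≡ ∣ Δ ∣
length-elements []            = refl
length-elements (inside ∷ Δ)  = cong suc (trans (List.length-map suc (elements Δ)) (length-elements Δ))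
length-elements (outside ∷ Δ) = trans (List.length-map suc (elements Δ)) (length-elements Δ)

∈-elements⁻ : ∀ {n} (Δ : Subset n) {x} → x ∈ elements Δ → x ∈ˢ Δ
∈-elements⁻ (inside ∷ Δ)  (here refl) = Vec.here
∈-elements⁻ (inside ∷ Δ)  (there x∈) with _ , y∈ , refl ← ∈-map⁻ suc x∈ = Vec.there (∈-elements⁻ Δ y∈)
∈-elements⁻ (outside ∷ Δ) x∈         with _ , y∈ , refl ← ∈-map⁻ suc x∈ = Vec.there (∈-elements⁻ Δ y∈)

elements-unique : ∀ {n} (Δ : Subset n) → Unique (elements Δ)
elements-unique []            = []
elements-unique (inside ∷ Δ)  = All.map⁺ (All.universal (λ _ ()) (elements Δ)) ∷ Unique.map⁺ Fin.suc-injective (elements-unique Δ)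
elements-unique (outside ∷ Δ) = Unique.map⁺ Fin.suc-injective (elements-unique Δ)

-- Factorials outgrow exponentials.

^≤! : ∀ m r → suc m ^ r ≤ (r + m) !
^≤! m zero    = ℕ.1≤n! m
^≤! m (suc r) = ℕ.*-mono-≤ (s≤s (ℕ.m≤n+m m r)) (^≤! m r)

-- With B = 2^D, the chain is 2^(2rD) = (B B)^r < (r+1)^r ≤ (2r)!, the last because r of the factors
-- of (2r)! exceed r.
2^<! : ∀ D r .{{_ : NonZero r}} → 2 ^ D * 2 ^ D ≤ r → 2 ^ ((r + r) * D) < (r + r) !
2^<! D r B²≤r = begin-strict
  2 ^ ((r + r) * D)      ≡⟨ cong (2 ^_) (exponent r D) ⟩
  2 ^ ((D + D) * r)      ≡⟨ ℕ.^-*-assoc 2 (D + D) r ⟨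
  (2 ^ (D + D)) ^ r      ≡⟨ cong (_^ r) (ℕ.^-distribˡ-+-* 2 D D) ⟩
  (2 ^ D * 2 ^ D) ^ r    <⟨ ℕ.^-monoˡ-< r (s≤s B²≤r) ⟩
  suc r ^ r              ≤⟨ ^≤! r r ⟩
  (r + r) !              ∎
  where
  open ℕ.≤-Reasoning
  exponent : ∀ r D → (r + r) * D ≡ (D + D) * r
  exponent = solve-∀

-- Abstract, so that the huge closed form of n is never unfolded.
abstract

  largeParameters : ∀ k q N₁ N₂ .{{_ : NonZero q}} →
                    ∃₂ λ ℓ n → N₁ ≤ n × N₂ ≤ n × 0 < ℓ × n ≡ q * (5 * ℓ) × 2 ^ (n * k) < ℓ !
  -- This r exceeds both thresholds and B B, and as a successor it is nonzero.
  largeParameters k q N₁ N₂ = go (suc (N₁ + N₂ + B * B))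
      (ℕ.m≤n⇒m≤1+n (ℕ.≤-trans (ℕ.m≤m+n N₁ N₂) (ℕ.m≤m+n (N₁ + N₂) (B * B))))
      (ℕ.m≤n⇒m≤1+n (ℕ.≤-trans (ℕ.m≤n+m N₂ N₁) (ℕ.m≤m+n (N₁ + N₂) (B * B))))
      (ℕ.m≤n⇒m≤1+n (ℕ.m≤n+m (B * B) (N₁ + N₂)))
    where
    B : ℕ
    B = 2 ^ (q * 5 * k)
    exponent : ∀ q ℓ k → ℓ * (q * 5 * k) ≡ q * (5 * ℓ) * k
    exponent = solve-∀
    go : ∀ r .{{_ : NonZero r}} → N₁ ≤ r → N₂ ≤ r → B * B ≤ r →
         ∃₂ λ ℓ n → N₁ ≤ n × N₂ ≤ n × 0 < ℓ × n ≡ q * (5 * ℓ) × 2 ^ (n * k) < ℓ !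
    go r N₁≤r N₂≤r B²≤r =
        -- Here ℓ = 2r and n = 5qℓ. Then n/q = 5ℓ is more than 4ℓ, and nk = ℓ D with D = 5qk.
        r + r , q * (5 * (r + r)) , ℕ.≤-trans N₁≤r r≤n , ℕ.≤-trans N₂≤r r≤n
      , ℕ.<-≤-trans (>-nonZero⁻¹ r) (ℕ.m≤m+n r r) , refl
      , subst (λ e → 2 ^ e < (r + r) !) (exponent q (r + r) k) (2^<! (q * 5 * k) r B²≤r)
      where
      r≤n : r ≤ q * (5 * (r + r))
      r≤n = ℕ.≤-trans (ℕ.m≤m+n r r) (ℕ.≤-trans (ℕ.m≤n*m (r + r) 5) (ℕ.m≤n*m (5 * (r + r)) q))

-- The bound on the number of singletons, and the contradiction.

singletons-small : ∀ (G : Permutation′ n → Set) → IsSubgroup G → ∀ {m} ℓ → IndexAtMost G m → m < ℓ ! →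
                   ∀ Δ {P} → IsSPA G P → (∀ x → x ∈ˢ Δ → IsSingletonPart P x) → ∣ Δ ∣ ≤ 4 * ℓ
singletons-small G isG ℓ index m<ℓ! Δ isSPA singletons = ℕ.≮⇒≥ λ 4ℓ<|Δ| →
  -- The goal is now absurdity, so a sunflower known only up to double negation suffices.
  sunflower G isG ℓ index m<ℓ! 4 (elements Δ) (elements-unique Δ)
    (subst (4 * ℓ <_) (sym (length-elements Δ)) 4ℓ<|Δ|)
    λ S → sunflower⇒¬singleton G isG S isSPA (singletons _ (∈-elements⁻ Δ (Sunflower.x∈L S)))

theorem8p8 : (k : ℕ) (G : (n : ℕ) → Permutation′ n → Set) →
    (∀ n → IsSubgroup (G n)) →
    (∃[ N ] ∀ n → N ≤ n → IndexAtMost (G n) (2 ^ (n * k))) →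
    ¬ (Σ ℕ λ p → Σ ℕ λ q → 0 < p × p ≤ q ×
    (∃[ N ] ∀ n → N ≤ n → LargeSingletonSet (G n) p q))
theorem8p8 k G isG (N₁ , index) (suc p , q@(suc _) , _ , _ , N₂ , large)
  with ℓ , n , N₁≤n , N₂≤n , 0<ℓ , n≡ , 2^nk<ℓ! ← largeParameters k q N₁ N₂
  with Δ , pn≤q|Δ| , P , isSPA , singletons ← large n N₂≤n =
  ℕ.<⇒≱ (ℕ.m<n+m (4 * ℓ) 0<ℓ) (ℕ.≤-trans 5ℓ≤|Δ|
    (singletons-small (G n) (isG n) ℓ (index n N₁≤n) 2^nk<ℓ! Δ isSPA singletons))
  where
  5ℓ≤|Δ| : 5 * ℓ ≤ ∣ Δ ∣
  -- The numerator is at least 1, so 5qℓ = n ≤ q |Δ|, and q cancels.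
  5ℓ≤|Δ| = ℕ.*-cancelˡ-≤ q (subst (_≤ q * ∣ Δ ∣) n≡ (ℕ.≤-trans (ℕ.m≤m+n n (p * n)) pn≤q|Δ|))
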